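{- Let $d_1\le d_2\le\ldots\le d_n$ be the degree sequence of a graph $G$, and let $\delta=d_1$ be its minimum degree. If $d_\delta+d_{\delta+1}\ge n$, then $G$ is Hamiltonian.
   Context: Graphs are finite and undirected, with neither loops nor multiple edges. The order $n$ of $G$ is its number of vertices. The degree sequence $d_1\le d_2\le\ldots\le d_n$ lists the degrees of all $n$ vertices of $G$ in nondecreasing order, indexed from $1$; its first term $d_1$ is the minimum degree of $G$, denoted $\delta$. Thus $d_\delta$ and $d_{\delta+1}$ are the $\delta$-th and $(\delta+1)$-th terms of this sequence. A graph is Hamiltonian if it contains a Hamilton cycle, that is, a simple spanning cycle.
   Formalization: The order n is assumed to be at least 3; this excludes only the complete graph on two vertices, which satisfies the degree condition (1 + 1 ≥ 2) but contains no cycle. -}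

module Defs where

open import Data.Fin using (Fin; toℕ)
import Data.Fin as Fin
open import Data.Fin.Permutation using (Permutation′; _⟨$⟩ʳ_)
open import Data.List using (List; _∷_; _++_; [_]; length; filter; allFin)
open import Data.List.Membership.Propositional using (_∈_)
open import Data.List.Relation.Unary.Linked using (Linked)
open import Data.List.Relation.Unary.Unique.Propositional using (Unique)
open import Data.Nat using (ℕ; suc; _≤_)
open import Data.Product using (Σ; ∃; _×_)
open import Level using (0ℓ)
open import Relation.Binary using (Rel; Symmetric; Irreflexive; Decidable; _Preserves_⟶_)
open import Relation.Binary.PropositionalEquality using (_≡_)

record Graph (n : ℕ) : Set₁ where
  field
    Adj    : Rel (Fin n) 0ℓ
    adj?   : Decidable Adj
    sym    : Symmetric Adj
    irrefl : Irreflexive _≡_ Adj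

module _ {n : ℕ} (G : Graph n) where
  open Graph G

  degree : Fin n → ℕ
  degree v = length (filter (adj? v) (allFin n))

  -- The permutation accounts for multiplicity: each vertex contributes
  -- exactly one term.
  record IsDegreeSequence (d : Fin n → ℕ) : Set where
    field
      nondecreasing : d Preserves Fin._≤_ ⟶ _≤_
      listsDegrees  : ∃ λ (π : Permutation′ n) → ∀ i → d i ≡ degree (π ⟨$⟩ʳ i)

  -- The distinct vertices of the cycle are start ∷ rest; the closing edge
  -- leads from the last of them back to start.
  record Cycle : Set where
    field
      start    : Fin n
      rest     : List (Fin n)

    vertices : List (Fin n)
    vertices = start ∷ rest

    field
      length≥3 : 3 ≤ length vertices
      distinct : Unique vertices
      closed   : Linked Adj (vertices ++ [ start ])

  Spanning : Cycle → Set
  Spanning c = ∀ v → v ∈ Cycle.vertices c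

  Hamiltonian : Set
  Hamiltonian = Σ Cycle Spanning

-- Term d k x: the k-th term of d exists and equals x, where terms are counted
-- from 1.  In particular no x satisfies Term d 0 x.
Term : ∀ {n} → (Fin n → ℕ) → ℕ → ℕ → Set
Term {n} d k x = Σ (Fin n) λ i → suc (toℕ i) ≡ k × d i ≡ x

{-# OPTIONS --safe #-}
-- The condition makes the Bondy–Chvátal closure of G complete, three rounds of
-- adding all edges between vertices of degree sum at least n being enough.
-- Call a vertex high if it comes after position δ in the degree sequence.
-- Round 1 joins the high vertices to each other and to the vertex in position
-- δ, so that each high vertex gets degree at least n − δ; round 2 joins them to
-- everything, as all degrees are at least δ; now every vertex has degree at
-- least n − δ, because there are n − δ high ones, and round 3 completes the
-- graph.
--
-- To undo a round, take a Hamilton cycle that uses some of the new edges.  If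
-- yx is a new edge of it, the degree sum of x and y gives consecutive vertices
-- p, q on the remaining path from x to y with p adjacent to y and q adjacent
-- to x in the old graph; exchanging yx and pq for py and qx leaves fewer new
-- edges.
module Submission where

open import Defs
open import Data.Empty using (⊥-elim)
open import Data.Fin using (Fin; toℕ; zero; suc; fromℕ<; inject≤)
open import Data.Fin.Properties using (_≟_; injective⇒≤; toℕ-injective; toℕ-inject≤; toℕ-fromℕ<; toℕ<n)
open import Data.Fin.Permutation using (_⟨$⟩ʳ_; _⟨$⟩ˡ_; inverseʳ)
open import Data.List using (List; []; _∷_; _++_; [_]; length; filter; allFin; lookup; tabulate)
open import Data.List.Properties using (length-++; length-tabulate; filter-reject)
open import Data.List.Membership.Propositional using (_∈_)
open import Data.List.Membership.Propositional.Properties using (∈-++⁺ˡ; ∈-++⁺ʳ; ∈-filter⁺; ∈-allFin; ∈-tabulate⁺)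
open import Data.List.Relation.Binary.Permutation.Propositional using (_↭_; ↭⇒↭ₛ; ↭-refl; ↭-sym; ↭-trans; prep)
open import Data.List.Relation.Binary.Permutation.Propositional.Properties
  using (∈-resp-↭; ↭-length; filter-↭; ++-comm; ++⁺ˡ; ∷↭∷ʳ)
import Data.List.Relation.Binary.Permutation.Setoid.Properties as Permutationₛ
open import Data.List.Relation.Binary.Sublist.Propositional using (⊆-refl)
open import Data.List.Relation.Binary.Sublist.Propositional.Properties using (length-mono-≤; filter⁺)
import Data.List.Relation.Unary.All as All
open import Data.List.Relation.Unary.AllPairs using ([]; _∷_)
open import Data.List.Relation.Unary.Any using (here; there; index)
open import Data.List.Relation.Unary.Any.Properties using (lookup-index)
open import Data.List.Relation.Unary.Linked using (Linked; [-]; _∷_)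
open import Data.List.Relation.Unary.Unique.Propositional using (Unique)
open import Data.List.Relation.Unary.Unique.Propositional.Properties using (allFin⁺)
open import Data.Nat using (ℕ; zero; suc; _+_; _≤_; _<_; _≥_; z≤n; s≤s; s≤s⁻¹; _≤?_; _<?_)
open import Data.Nat.Properties hiding (_≟_; _≤?_; _<?_)
open import Data.Product using (∃; _×_; _,_; proj₁; proj₂)
open import Data.Sum using (_⊎_; inj₁; inj₂)
open import Relation.Binary.PropositionalEquality
  using (_≡_; _≢_; refl; sym; trans; cong; cong₂; subst; ≢-sym; setoid)
open import Relation.Nullary using (yes; no; contradiction)
open import Relation.Nullary.Decidable using (_⊎-dec_; _×-dec_; ¬?)

-- Counting vertices through lists

covering⇒≤length : ∀ {n} (xs : List (Fin n)) → (∀ v → v ∈ xs) → n ≤ length xs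
covering⇒≤length xs cover = injective⇒≤ index-injective
  where
  index-injective : ∀ {u v} → index (cover u) ≡ index (cover v) → u ≡ v
  index-injective {u} {v} eq =
    trans (lookup-index (cover u)) (trans (cong (lookup xs) eq) (sym (lookup-index (cover v))))

unique-↭-allFin : ∀ {n} {xs : List (Fin n)} → xs ↭ allFin n → Unique xs
unique-↭-allFin {n} p = Permutationₛ.Unique-resp-↭ (setoid (Fin n)) (↭⇒↭ₛ (↭-sym p)) (allFin⁺ n)

-- One round of the closure, and tours that use its new edges

module _ {n} (G : Graph n) where
  open Graph G renaming (sym to adj-sym)

  -- The list `xs` followed by the neighbours of `v` contains every vertex. As `v` is not its own
  -- neighbour, `xs` has to contain it.
  nonNeighbours-cover⇒n≤ : ∀ v (xs : List (Fin n)) → (∀ w → w ∈ xs ⊎ Adj v w) →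
                           n ≤ length xs + degree G v
  nonNeighbours-cover⇒n≤ v xs cover =
    subst (n ≤_) (length-++ xs) (covering⇒≤length (xs ++ filter (adj? v) (allFin n)) member)
    where
    member : ∀ w → w ∈ xs ++ filter (adj? v) (allFin n)
    member w with cover w
    ... | inj₁ w∈xs = ∈-++⁺ˡ w∈xs
    ... | inj₂ v~w  = ∈-++⁺ʳ xs (∈-filter⁺ (adj? v) (∈-allFin w) v~w)

  closeOnce : Graph n
  closeOnce = record
    { Adj    = λ u v → Adj u v ⊎ (u ≢ v × n ≤ degree G u + degree G v)
    ; adj?   = λ u v → adj? u v ⊎-dec (¬? (u ≟ v) ×-dec (n ≤? degree G u + degree G v))
    ; sym    = λ { {u} {v} (inj₁ u~v) → inj₁ (adj-sym u~v)
                 ; {u} {v} (inj₂ (u≢v , le)) →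
                     inj₂ (≢-sym u≢v , subst (n ≤_) (+-comm (degree G u) _) le) }
    ; irrefl = λ { u≡v (inj₁ u~v) → irrefl u≡v u~v ; u≡v (inj₂ (u≢v , _)) → u≢v u≡v }
    }

  degree≤degree-closeOnce : ∀ v → degree G v ≤ degree closeOnce v
  degree≤degree-closeOnce v =
    length-mono-≤ (filter⁺ (adj? v) (Graph.adj? closeOnce v) (λ { refl → inj₁ }) (⊆-refl {x = allFin n}))

  -- The index counts the edges that are not known to be edges of G.
  data Edge : ℕ → Fin n → Fin n → Set where
    old : ∀ {u v} → Adj u v → Edge 0 u v
    new : ∀ {u v} → n ≤ degree G u + degree G v → Edge 1 u v

  edge-sym : ∀ {e u v} → Edge e u v → Edge e v u
  edge-sym (old u~v)        = old (adj-sym u~v)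
  edge-sym (new {u} {v} le) = new (subst (n ≤_) (+-comm (degree G u) _) le)

  -- Walk k x y l: a walk x ∷ l from x to y with k new edges.
  data Walk : ℕ → Fin n → Fin n → List (Fin n) → Set where
    stop : ∀ {x} → Walk 0 x x []
    step : ∀ {e k x y z l} → Edge e x y → Walk k y z l → Walk (e + k) x z (y ∷ l)

  reindex : ∀ {k k′ x y l} → k ≡ k′ → Walk k x y l → Walk k′ x y l
  reindex refl w = w

  append : ∀ {i e j x p q y l₁ l₂} → Walk i x p l₁ → Edge e p q → Walk j q y l₂ →
           Walk (i + (e + j)) x y (l₁ ++ q ∷ l₂)
  append stop pq w₂ = step pq w₂
  append {e = e} {j} (step {e′} {i} xz w₁) pq w₂ =
    reindex (sym (+-assoc e′ i (e + j))) (step xz (append w₁ pq w₂))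

  reverse : ∀ {k x y l} → Walk k x y l → ∃ λ l′ → Walk k y x l′ × y ∷ l′ ↭ x ∷ l
  reverse stop = [] , stop , ↭-refl
  reverse {y = z} (step {e} {k} {x} xy w) with reverse w
  ... | l′ , w′ , z∷l′↭y∷l =
    l′ ++ [ x ] ,
    reindex (trans (cong (k +_) (+-identityʳ e)) (+-comm k e))
      (append w′ (edge-sym xy) stop) ,
    ↭-trans (↭-sym (∷↭∷ʳ x (z ∷ l′))) (prep x z∷l′↭y∷l)

  -- Common result of two searches, for a new edge and for an edge to exchange: the walk is cut at
  -- an edge that satisfies `P`.
  record Split (P : ∀ {e p q} → Edge e p q → Set)
               (k : ℕ) (x y : Fin n) (l : List (Fin n)) : Set where
    constructor split
    field
      {i e j}  : ℕ
      {p q}    : Fin n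
      {l₁ l₂}  : List (Fin n)
      before   : Walk i x p l₁
      {middle} : Edge e p q
      holds    : P middle
      after    : Walk j q y l₂
      count    : k ≡ i + (e + j)
      parts    : l ≡ l₁ ++ q ∷ l₂

  step-split : ∀ {P : ∀ {e p q} → Edge e p q → Set} {e k x y z l} →
               Edge e x y → Split P k y z l → Split P (e + k) x z (y ∷ l)
  step-split {e = e} xy (split {i = i} w₁ holds w₂ refl refl) =
    split (step xy w₁) holds w₂ (sym (+-assoc e i _)) refl

  data IsNew : ∀ {e p q} → Edge e p q → Set where
    new : ∀ {p q} (le : n ≤ degree G p + degree G q) → IsNew (new le)

  findNew : ∀ {k x y l} → Walk k x y l → k ≡ 0 ⊎ Split IsNew k x y l
  findNew stop              = inj₁ refl
  findNew (step (new le) w) = inj₂ (split stop (new le) w refl refl)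
  findNew (step (old a) w) with findNew w
  ... | inj₁ k≡0 = inj₁ k≡0
  ... | inj₂ s   = inj₂ (step-split (old a) s)

  neighbours : Fin n → List (Fin n) → ℕ
  neighbours v xs = length (filter (adj? v) xs)

  -- Edges of the walk whose first end is adjacent to `y` and edges whose second end is adjacent to
  -- `x` together outnumber all its edges, because the last vertex `y` is not adjacent to itself; so
  -- some edge is of both kinds. Since `x` need not be the start of the walk, the induction can drop
  -- leading edges.
  crossing : ∀ {k p y l} x → Walk k p y l →
             suc (length l) ≤ neighbours y (p ∷ l) + neighbours x l →
             Split (λ {_} {p} {q} _ → Adj y p × Adj x q) k p y l
  crossing {y = y} x stop le with adj? y y
  ... | yes y~y = ⊥-elim (irrefl refl y~y)
  ... | no  _   = contradiction le λ ()
  crossing {p = p} {y} x (step {y = q} {l = l} pq w) le with adj? y p | adj? x q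
  ... | yes y~p | yes x~q = split stop {pq} (y~p , x~q) w refl refl
  ... | yes _   | no _    = step-split pq (crossing x w (s≤s⁻¹ le))
  ... | no _    | no _    = step-split pq (crossing x w (≤-trans (n≤1+n _) le))
  ... | no _    | yes _   = step-split pq (crossing x w
    (s≤s⁻¹ (subst (suc (suc (length l)) ≤_) (+-suc (neighbours y (q ∷ l)) _) le)))

  -- A spanning cycle cut open at `closing`. The new edges are only bounded by `m`, since one
  -- exchange may remove two of them.
  record Tour (m : ℕ) : Set where
    constructor tour
    field
      {e k}    : ℕ
      {x y}    : Fin n
      {l}      : List (Fin n)
      walk     : Walk k x y l
      closing  : Edge e y x
      spanning : x ∷ l ↭ allFin n
      bound    : e + k ≤ m

  neighbours-spanning : ∀ {l} v → l ↭ allFin n → neighbours v l ≡ degree G v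
  neighbours-spanning v sp = ↭-length (filter-↭ (adj? v) sp)

  -- Cutting at the edge pq found by `crossing` and reversing the part after it gives the cycle x
  -- ... p y ... q x. The edges py and qx are old, so the cycle has no more new edges than the path.
  uncross : ∀ {k x y l} → Walk k x y l → x ∷ l ↭ allFin n →
            n ≤ degree G x + degree G y → Tour k
  uncross {k} {x} {y} {l} w sp le with crossing x w le′
    where
    le′ : suc (length l) ≤ neighbours y (x ∷ l) + neighbours x l
    le′ = begin
      suc (length l)                            ≡⟨ ↭-length sp ⟩
      length (allFin n)                         ≡⟨ length-tabulate (λ i → i) ⟩
      n                                         ≤⟨ le ⟩
      degree G x + degree G y                   ≡⟨ +-comm (degree G x) _ ⟩
      degree G y + degree G x                   ≡⟨ cong₂ _+_ (neighbours-spanning y sp) (neighbours-spanning x sp) ⟨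
      neighbours y (x ∷ l) + neighbours x (x ∷ l) ≡⟨ cong (λ xs → neighbours y (x ∷ l) + length xs)
                                                     (filter-reject (adj? x) (irrefl refl)) ⟩
      neighbours y (x ∷ l) + neighbours x l     ∎
      where open ≤-Reasoning
  ... | split {i} {e} {j} {l₁ = l₁} w₁ (y~p , x~q) w₂ refl refl with reverse w₂
  ...   | l₃ , w₃ , y∷l₃↭q∷l₂ =
    tour (append w₁ (old (adj-sym y~p)) w₃) (old (adj-sym x~q))
         (↭-trans (prep x (++⁺ˡ l₁ y∷l₃↭q∷l₂)) sp)
         (+-monoʳ-≤ i (m≤n+m j e))

  -- The exchange discards the edge at which the cycle is open, so this edge should be new; if it is
  -- old, the cycle is first reopened elsewhere.
  improve : ∀ {m} → Tour (suc m) → Tour m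
  improve (tour w (new {y} {x} le) sp b) with uncross w sp (subst (n ≤_) (+-comm (degree G y) _) le)
  ... | tour w′ c sp′ b′ = tour w′ c sp′ (≤-trans b′ (s≤s⁻¹ b))
  improve (tour w (old a) sp b) with findNew w
  ... | inj₁ refl = tour w (old a) sp z≤n
  -- Reopened at the new edge pq, the cycle becomes the path q ... y x ... p, with one new edge
  -- fewer.
  ... | inj₂ (split {i} {j = j} {q = q} {l₂ = l₂} w₁ (new {p} le) w₂ refl refl)
    with uncross (append w₂ (old a) w₁) (↭-trans (++-comm (q ∷ l₂) _) sp)
           (subst (n ≤_) (+-comm (degree G p) _) le)
  ...   | tour w′ c sp′ b′ = tour w′ c sp′ (≤-trans b′ (s≤s⁻¹ (begin
    suc (j + i)   ≡⟨ cong suc (+-comm j i) ⟩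
    suc (i + j)   ≡⟨ +-suc i j ⟨
    i + suc j     ≤⟨ b ⟩
    suc _         ∎)))
    where open ≤-Reasoning

  tour⇒tour₀ : ∀ m → Tour m → Tour 0
  tour⇒tour₀ zero    t = t
  tour⇒tour₀ (suc m) t = tour⇒tour₀ m (improve t)

  old-edge : ∀ {e u v} → Edge e u v → e ≡ 0 → Adj u v
  old-edge (old a) _ = a

  walk⇒linked : ∀ {k x y z l} → Walk k x y l → k ≡ 0 → Adj y z → Linked Adj (x ∷ l ++ [ z ])
  walk⇒linked stop _ a = a ∷ [-]
  walk⇒linked (step {e} xy w) eq a =
    old-edge xy (m+n≡0⇒m≡0 e eq) ∷ walk⇒linked w (m+n≡0⇒n≡0 e eq) a

  tour₀⇒hamiltonian : 3 ≤ n → Tour 0 → Hamiltonian G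
  tour₀⇒hamiltonian 3≤n (tour {e} {x = x} {l = l} w c sp b) =
    record
      { start    = x
      ; rest     = l
      ; length≥3 = subst (3 ≤_) (sym (trans (↭-length sp) (length-tabulate (λ i → i)))) 3≤n
      ; distinct = unique-↭-allFin sp
      ; closed   = walk⇒linked w (m+n≡0⇒n≡0 e (n≤0⇒n≡0 b)) (old-edge c (m+n≡0⇒m≡0 e (n≤0⇒n≡0 b)))
      } , λ v → ∈-resp-↭ (↭-sym sp) (∈-allFin v)

  -- Membership of the end `y` in the list shows that `y` differs from a vertex outside it, as
  -- needed to close the cycle.
  unique⇒walk : (∀ {u v} → u ≢ v → Adj u v) → ∀ x l → Unique (x ∷ l) →
                ∃ λ y → y ∈ x ∷ l × Walk 0 x y l
  unique⇒walk complete x []      _              = x , here refl , stop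
  unique⇒walk complete x (z ∷ l) ((x≢z All.∷ _) ∷ u) with unique⇒walk complete z l u
  ... | y , y∈ , w = y , there y∈ , step (old (complete x≢z)) w

-- Undoing a round, and tours of complete graphs

module _ {n} (G : Graph n) where

  edge-closeOnce : ∀ {e u v} → Edge (closeOnce G) e u v → e ≡ 0 → ∃ λ e′ → Edge G e′ u v
  edge-closeOnce (old (inj₁ u~v))      _ = 0 , old u~v
  edge-closeOnce (old (inj₂ (_ , le))) _ = 1 , new le

  walk-closeOnce : ∀ {k x y l} → Walk (closeOnce G) k x y l → k ≡ 0 → ∃ λ k′ → Walk G k′ x y l
  walk-closeOnce stop _ = 0 , stop
  walk-closeOnce (step {e} xy w) eq
    with edge-closeOnce xy (m+n≡0⇒m≡0 e eq) | walk-closeOnce w (m+n≡0⇒n≡0 e eq)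
  ... | e′ , xy′ | k′ , w′ = e′ + k′ , step xy′ w′

  -- Each edge of the tour is an old or a new edge over `G`; as many exchanges as there are new ones
  -- remove them all.
  tour₀-closeOnce : Tour (closeOnce G) 0 → Tour G 0
  tour₀-closeOnce (tour {e} w c sp b)
    with edge-closeOnce c (m+n≡0⇒m≡0 e (n≤0⇒n≡0 b)) | walk-closeOnce w (m+n≡0⇒n≡0 e (n≤0⇒n≡0 b))
  ... | e′ , c′ | k′ , w′ = tour⇒tour₀ G (e′ + k′) (tour w′ c′ sp ≤-refl)

complete⇒tour₀ : ∀ {n} (G : Graph n) → 3 ≤ n → (∀ {u v} → u ≢ v → Graph.Adj G u v) → Tour G 0
complete⇒tour₀ {suc zero} G (s≤s ())
complete⇒tour₀ {suc (suc n)} G 3≤n complete with allFin⁺ (suc (suc n))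
... | x∉ ∷ u with unique⇒walk G complete (suc zero) _ u
...   | y , y∈ , w =
  tour (step (old (complete λ ())) w) (old (complete (≢-sym (All.lookup x∉ y∈)))) ↭-refl z≤n

-- Three rounds complete the graph

module _ {n} (G : Graph n) {d : Fin n → ℕ} (isDS : IsDegreeSequence G d)
         {m : ℕ} (m<n : m < n) (minimum : ∀ i → suc m ≤ d i)
         {s t : Fin n} (toℕs≡m : toℕ s ≡ m) (toℕt≡1+m : toℕ t ≡ suc m)
         (n≤ds+dt : n ≤ d s + d t) where
  open IsDegreeSequence isDS

  private
    π  = proj₁ listsDegrees
    G₁ = closeOnce G
    G₂ = closeOnce G₁
    G₃ = closeOnce G₂

  -- Ranks start at 0 and `suc m` stands for δ: position δ has rank `m`, and the high vertices are
  -- those of rank at least `suc m`.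
  rank : Fin n → ℕ
  rank v = toℕ (π ⟨$⟩ˡ v)

  degree≡ : ∀ v → d (π ⟨$⟩ˡ v) ≡ degree G v
  degree≡ v = trans (proj₂ listsDegrees _) (cong (degree G) (inverseʳ π))

  δ≤degree : ∀ v → suc m ≤ degree G v
  δ≤degree v = subst (suc m ≤_) (degree≡ v) (minimum _)

  rank-mono : ∀ i v → toℕ i ≤ rank v → d i ≤ degree G v
  rank-mono i v le = subst (d i ≤_) (degree≡ v) (nondecreasing le)

  first : ∀ k → k ≤ n → List (Fin n)
  first k k≤n = tabulate {n = k} λ i → π ⟨$⟩ʳ inject≤ i k≤n

  length-first : ∀ {k} (k≤n : k ≤ n) → length (first k k≤n) ≡ k
  length-first k≤n = length-tabulate λ i → π ⟨$⟩ʳ inject≤ i k≤n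

  ∈-first : ∀ {k} (k≤n : k ≤ n) v → rank v < k → v ∈ first k k≤n
  ∈-first {k} k≤n v r<k = subst (_∈ first k k≤n) eq (∈-tabulate⁺ (fromℕ< r<k))
    where
    eq : π ⟨$⟩ʳ inject≤ (fromℕ< r<k) k≤n ≡ v
    eq = trans (cong (π ⟨$⟩ʳ_) (toℕ-injective (trans (toℕ-inject≤ _ k≤n) (toℕ-fromℕ< r<k))))
               (inverseʳ π)

  -- All vertices not adjacent to a high `v` in `G₁` are among `v` itself and the `m` vertices of
  -- rank below `m`.
  n≤δ+degree₁ : ∀ v → suc m ≤ rank v → n ≤ suc m + degree G₁ v
  n≤δ+degree₁ v δ≤r =
    subst (λ k → n ≤ suc k + degree G₁ v) (length-first (<⇒≤ m<n))
      (nonNeighbours-cover⇒n≤ G₁ v (v ∷ first m (<⇒≤ m<n)) cover)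
    where
    cover : ∀ w → w ∈ v ∷ first m (<⇒≤ m<n) ⊎ Graph.Adj G₁ v w
    cover w with w ≟ v | rank w <? m
    ... | yes w≡v | _       = inj₁ (here w≡v)
    ... | no _    | yes r<m = inj₁ (there (∈-first (<⇒≤ m<n) w r<m))
    -- Here `w` has degree at least `d s` and the high vertex `v` at least `d t`, so round 1 joins
    -- them.
    ... | no w≢v  | no r≮m  = inj₂ (inj₂ (≢-sym w≢v , (begin
      n                        ≤⟨ n≤ds+dt ⟩
      d s + d t                ≤⟨ +-mono-≤ (rank-mono s w (subst (_≤ rank w) (sym toℕs≡m) (≮⇒≥ r≮m)))
                                           (rank-mono t v (subst (_≤ rank v) (sym toℕt≡1+m) δ≤r)) ⟩
      degree G w + degree G v  ≡⟨ +-comm (degree G w) _ ⟩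
      degree G v + degree G w  ∎)))
      where open ≤-Reasoning

  high-adjacent₂ : ∀ {v w} → suc m ≤ rank v → w ≢ v → Graph.Adj G₂ w v
  high-adjacent₂ {v} {w} δ≤r w≢v = inj₂ (w≢v ,
    ≤-trans (n≤δ+degree₁ v δ≤r)
      (+-monoˡ-≤ (degree G₁ v) (≤-trans (δ≤degree w) (degree≤degree-closeOnce G w))))

  -- High vertices keep their bound from round 1. A low vertex is adjacent in `G₂` to all high ones,
  -- which leaves only the first δ vertices.
  n≤δ+degree₂ : ∀ v → n ≤ suc m + degree G₂ v
  n≤δ+degree₂ v with rank v <? suc m
  ... | no  r≮δ = ≤-trans (n≤δ+degree₁ v (≮⇒≥ r≮δ)) (+-monoʳ-≤ (suc m) (degree≤degree-closeOnce G₁ v))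
  ... | yes r<δ = subst (λ k → n ≤ k + degree G₂ v) (length-first m<n)
                    (nonNeighbours-cover⇒n≤ G₂ v (first (suc m) m<n) cover)
    where
    cover : ∀ w → w ∈ first (suc m) m<n ⊎ Graph.Adj G₂ v w
    cover w with rank w <? suc m
    ... | yes r′<δ = inj₁ (∈-first m<n w r′<δ)
    ... | no  r′≮δ = inj₂ (high-adjacent₂ (≮⇒≥ r′≮δ) λ { refl → r′≮δ r<δ })

  complete₃ : ∀ {u v} → u ≢ v → Graph.Adj G₃ u v
  complete₃ {u} {v} u≢v = inj₂ (u≢v , ≤-trans (n≤δ+degree₂ v) (+-monoˡ-≤ (degree G₂ v) (begin
    suc m        ≤⟨ δ≤degree u ⟩
    degree G u   ≤⟨ degree≤degree-closeOnce G u ⟩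
    degree G₁ u  ≤⟨ degree≤degree-closeOnce G₁ u ⟩
    degree G₂ u  ∎)))
    where open ≤-Reasoning

  hamiltonian : 3 ≤ n → Hamiltonian G
  hamiltonian 3≤n = tour₀⇒hamiltonian G 3≤n
    (tour₀-closeOnce G (tour₀-closeOnce G₁ (tour₀-closeOnce G₂ (complete⇒tour₀ G₃ 3≤n complete₃))))

theorem1 : ∀ (n : ℕ) → 3 ≤ n → (G : Graph n) →
    (d : Fin n → ℕ) → IsDegreeSequence G d →
    (δ : ℕ) → Term d 1 δ →
    (dδ dδ+1 : ℕ) → Term d δ dδ → Term d (suc δ) dδ+1 →
    dδ + dδ+1 ≥ n →
    Hamiltonian G
-- Existence of the term with index δ forces δ to be `suc (toℕ s)`, hence positive, so `toℕ s`
-- serves as `m`.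
theorem1 n 3≤n G d isDS δ (f , toℕf , df≡δ) _ _ (s , refl , refl) (t , toℕt , refl) n≤ =
  hamiltonian G isDS (toℕ<n s) minimum refl (suc-injective toℕt) n≤ 3≤n
  where
  minimum : ∀ i → suc (toℕ s) ≤ d i
  minimum i = subst (_≤ d i) df≡δ
    (IsDegreeSequence.nondecreasing isDS (subst (_≤ toℕ i) (sym (suc-injective toℕf)) z≤n))
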